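{- Let $n,k$ be positive integers with $n\ge 4k^3$. Then $$g(n,k,2)=g(n,k,3)=\binom{n-1}{k-1}.$$
   Context: Let $[n]=\{1,\dots,n\}$ and let $\binom{[n]}{k}$ be the family of all $k$-element subsets of $[n]$. For sets $A,B,C\subset[n]$ put $d(A,B,C)=|A\cap B|+|B\cap C|+|C\cap A|$. For a positive integer $\ell$, let $\mathbf{H}_\ell$ be the class of families $\mathcal{H}$ of subsets of $[n]$ such that $d(A,B,C)\ge \ell$ for all $A,B,C\in\mathcal{H}$ (no distinctness of $A,B,C$ is required in this definition). Define $g(n,k,\ell)=\max\{|\mathcal{F}| : \mathcal{F}\subset\binom{[n]}{k},\ \mathcal{F}\in\mathbf{H}_\ell\}$. -}

module Defs where

open import Data.Nat using (ℕ; zero; suc; _+_; _≤_; _≤?_; _≟_; z≤n; s≤s)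
open import Data.Nat.Properties using (+-suc; module ≤-Reasoning)
open import Data.Bool using (true; false)
open import Data.Bool.Properties using () renaming (_≟_ to _≟ᵇ_)
open import Data.Fin.Subset using (Subset; inside; outside; _∩_; ∣_∣)
open import Data.Vec using ([]; _∷_)
open import Data.Vec.Properties using (∷-injectiveʳ; ≡-dec)
open import Data.List using (List; []; _∷_; _++_; map; filter; length)
open import Data.List.Properties using (length-++)
open import Data.List.Extrema.Nat using (max; v≤max⁺; argmax-sel)
open import Data.List.Membership.Propositional using (_∈_)
open import Data.List.Membership.Propositional.Properties using (∈-map⁺; ∈-map⁻; ∈-++⁺ˡ; ∈-++⁺ʳ; ∈-++⁻; ∈-filter⁺; ∈-filter⁻; ∈-∃++)
import Data.List.Membership.DecPropositional as DecMembership
open import Data.List.Relation.Unary.All as All using (All; []; _∷_; all?)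
open import Data.List.Relation.Unary.Any using (here; there)
import Data.List.Relation.Unary.Any as Any
open import Data.List.Relation.Unary.AllPairs using ([]; _∷_)
open import Data.List.Relation.Unary.Unique.Propositional using (Unique)
import Data.List.Relation.Unary.Unique.Propositional.Properties as Unique
open import Data.Empty using (⊥)
open import Data.Product using (∃; _×_; _,_; proj₂)
open import Data.Sum using (inj₁; inj₂)
open import Relation.Nullary using (Dec; contradiction)
open import Relation.Nullary.Decidable using (map′)
open import Relation.Unary using (Decidable)
open import Relation.Binary.PropositionalEquality using (_≡_; refl; sym; cong)

-- [n] is represented by Fin n, so that its subsets are the elements of Subset n.

d : ∀ {n} → Subset n → Subset n → Subset n → ℕ
d A B C = ∣ A ∩ B ∣ + ∣ B ∩ C ∣ + ∣ C ∩ A ∣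

-- A list stands for the set of its entries.  Cardinalities are only taken of
-- lists without repetitions, where length is the cardinality.
Family : ℕ → Set
Family n = List (Subset n)

-- The class 𝐇_ℓ; A, B and C need not be distinct.
H : ∀ {n} → ℕ → Family n → Set
H ℓ 𝓗 = ∀ {A B C} → A ∈ 𝓗 → B ∈ 𝓗 → C ∈ 𝓗 → ℓ ≤ d A B C

H? : ∀ {n} ℓ → Decidable (H {n} ℓ)
H? ℓ 𝓗 = map′
  (λ h A∈ B∈ C∈ → All.lookup (All.lookup (All.lookup h A∈) B∈) C∈)
  (λ h → All.tabulate λ A∈ → All.tabulate λ B∈ → All.tabulate λ C∈ → h A∈ B∈ C∈)
  (all? (λ A → all? (λ B → all? (λ C → ℓ ≤? d A B C) 𝓗) 𝓗) 𝓗)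

subsets : ∀ n → List (Subset n)
subsets zero    = [] ∷ []
subsets (suc n) = map (inside ∷_) (subsets n) ++ map (outside ∷_) (subsets n)

-- The family ([n] choose k).
kSubsets : ∀ n → ℕ → Family n
kSubsets n k = filter (λ A → ∣ A ∣ ≟ k) (subsets n)

-- Applied to a list without repetitions, this lists every subset of its
-- underlying set exactly once.
sublists : ∀ {A : Set} → List A → List (List A)
sublists []       = [] ∷ []
sublists (x ∷ xs) = map (x ∷_) (sublists xs) ++ sublists xs

-- max { |𝓕| : 𝓕 ⊆ ([n] choose k), 𝓕 ∈ 𝐇_ℓ }.  The empty family qualifies, so
-- the default value 0 never affects the maximum; see g-isMaximum.
g : ℕ → ℕ → ℕ → ℕ
g n k ℓ = max 0 (map length (filter (H? ℓ) (sublists (kSubsets n k))))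

Admissible : ∀ n → ℕ → ℕ → Family n → Set
Admissible n k ℓ 𝓕 = Unique 𝓕 × All (λ A → ∣ A ∣ ≡ k) 𝓕 × H ℓ 𝓕

IsMaximum : ∀ n → ℕ → ℕ → ℕ → Set
IsMaximum n k ℓ m =
  (∃ λ 𝓕 → Admissible n k ℓ 𝓕 × length 𝓕 ≡ m) ×
  (∀ 𝓕 → Admissible n k ℓ 𝓕 → length 𝓕 ≤ m)

∈-subsets : ∀ {n} (A : Subset n) → A ∈ subsets n
∈-subsets []            = here refl
∈-subsets (inside  ∷ A) = ∈-++⁺ˡ (∈-map⁺ _ (∈-subsets A))
∈-subsets (outside ∷ A) = ∈-++⁺ʳ (map (inside ∷_) (subsets _)) (∈-map⁺ _ (∈-subsets A))

subsets-unique : ∀ n → Unique (subsets n)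
subsets-unique zero    = [] ∷ []
subsets-unique (suc n) =
  Unique.++⁺ (Unique.map⁺ ∷-injectiveʳ (subsets-unique n))
             (Unique.map⁺ ∷-injectiveʳ (subsets-unique n))
             disjoint
  where
  disjoint : ∀ {A} → A ∈ map (inside ∷_) (subsets n) × A ∈ map (outside ∷_) (subsets n) → ⊥
  disjoint (p , q) with ∈-map⁻ _ p | ∈-map⁻ _ q
  ... | _ , _ , refl | _ , _ , ()

module _ {A : Set} where

  filter∈sublists : ∀ {P : A → Set} (P? : Decidable P) (xs : List A) → filter P? xs ∈ sublists xs
  filter∈sublists P? []       = here refl
  filter∈sublists P? (x ∷ xs) with Dec.does (P? x)
  ... | true  = ∈-++⁺ˡ (∈-map⁺ (x ∷_) (filter∈sublists P? xs))
  ... | false = ∈-++⁺ʳ (map (x ∷_) (sublists xs)) (filter∈sublists P? xs)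

  ∈sublists⇒⊆ : ∀ (xs : List A) {ys} → ys ∈ sublists xs → ∀ {y} → y ∈ ys → y ∈ xs
  ∈sublists⇒⊆ [] (here refl) ()
  ∈sublists⇒⊆ (x ∷ xs) ys∈ y∈ with ∈-++⁻ (map (x ∷_) (sublists xs)) ys∈
  ... | inj₂ q = there (∈sublists⇒⊆ xs q y∈)
  ... | inj₁ p with ∈-map⁻ (x ∷_) p
  ...   | zs , zs∈ , refl with y∈
  ...     | here y≡x  = here y≡x
  ...     | there y∈′ = there (∈sublists⇒⊆ xs zs∈ y∈′)

  ∈sublists⇒Unique : ∀ (xs : List A) {ys} → Unique xs → ys ∈ sublists xs → Unique ys
  ∈sublists⇒Unique [] _ (here refl) = []
  ∈sublists⇒Unique (x ∷ xs) (x∉ ∷ u) ys∈ with ∈-++⁻ (map (x ∷_) (sublists xs)) ys∈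
  ... | inj₂ q = ∈sublists⇒Unique xs u q
  ... | inj₁ p with ∈-map⁻ (x ∷_) p
  ...   | zs , zs∈ , refl =
    All.tabulate (λ z∈ → All.lookup x∉ (∈sublists⇒⊆ xs zs∈ z∈)) ∷ ∈sublists⇒Unique xs u zs∈

  length-mono : ∀ {xs ys : List A} → Unique xs → (∀ {x} → x ∈ xs → x ∈ ys) → length xs ≤ length ys
  length-mono {[]}     _        _   = z≤n
  length-mono {x ∷ xs} (x∉ ∷ u) sub with ∈-∃++ (sub (here refl))
  ... | as , bs , refl = begin
    suc (length xs)               ≤⟨ s≤s (length-mono u sub′) ⟩
    suc (length (as ++ bs))       ≡⟨ cong suc (length-++ as) ⟩
    suc (length as + length bs)   ≡⟨ +-suc (length as) (length bs) ⟨
    length as + suc (length bs)   ≡⟨ length-++ as ⟨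
    length (as ++ x ∷ bs)         ∎
    where
    open ≤-Reasoning
    sub′ : ∀ {z} → z ∈ xs → z ∈ as ++ bs
    sub′ z∈ with ∈-++⁻ as (sub (there z∈))
    ... | inj₁ p           = ∈-++⁺ˡ p
    ... | inj₂ (there q)   = ∈-++⁺ʳ as q
    ... | inj₂ (here refl) = contradiction refl (All.lookup x∉ z∈)

g-isMaximum : ∀ n k ℓ → IsMaximum n k ℓ (g n k ℓ)
g-isMaximum n k ℓ = attained , bound
  where
  candidates : List (Family n)
  candidates = filter (H? ℓ) (sublists (kSubsets n k))

  attained : ∃ λ 𝓕 → Admissible n k ℓ 𝓕 × length 𝓕 ≡ g n k ℓ
  attained with argmax-sel (λ m → m) 0 (map length candidates)
  ... | inj₁ eq = [] , ([] , [] , λ ()) , sym eq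
  ... | inj₂ m∈ with ∈-map⁻ length m∈
  ...   | 𝓕 , 𝓕∈ , eq with ∈-filter⁻ (H? ℓ) {xs = sublists (kSubsets n k)} 𝓕∈
  ...     | 𝓕∈′ , h =
    𝓕 , ( ∈sublists⇒Unique (kSubsets n k) (Unique.filter⁺ _ (subsets-unique n)) 𝓕∈′
        , All.tabulate (λ A∈ → proj₂ (∈-filter⁻ (λ A → ∣ A ∣ ≟ k) {xs = subsets n}
                                                 (∈sublists⇒⊆ (kSubsets n k) 𝓕∈′ A∈)))
        , h ) , sym eq

  bound : ∀ 𝓕 → Admissible n k ℓ 𝓕 → length 𝓕 ≤ g n k ℓ
  bound 𝓕 (u , sizes , h) =
    v≤max⁺ 0 (map length candidates) (inj₂ (Any.map le (∈-map⁺ length 𝓖∈)))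
    where
    open DecMembership (≡-dec {n = n} _≟ᵇ_) using (_∈?_)
    𝓖 : Family n
    𝓖 = filter (_∈? 𝓕) (kSubsets n k)
    𝓖⊆𝓕 : ∀ {A} → A ∈ 𝓖 → A ∈ 𝓕
    𝓖⊆𝓕 A∈ = proj₂ (∈-filter⁻ (_∈? 𝓕) {xs = kSubsets n k} A∈)
    𝓖∈ : 𝓖 ∈ candidates
    𝓖∈ = ∈-filter⁺ (H? ℓ) {xs = sublists (kSubsets n k)} (filter∈sublists (_∈? 𝓕) (kSubsets n k))
           (λ A∈ B∈ C∈ → h (𝓖⊆𝓕 A∈) (𝓖⊆𝓕 B∈) (𝓖⊆𝓕 C∈))
    le : ∀ {m} → length 𝓖 ≡ m → length 𝓕 ≤ m
    le refl = length-mono u λ {A} A∈ →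
      ∈-filter⁺ (_∈? 𝓕) (∈-filter⁺ _ (∈-subsets A) (All.lookup sizes A∈)) A∈

{-# OPTIONS --safe #-}

-- The lower bound is the full star of a point.  For the upper bound, let 𝓕 be an
-- admissible family for ℓ = 2 that is not contained in a star.  If 𝓕 is intersecting,
-- fix A ∈ 𝓕 and for each x choose a member B x of 𝓕 that misses x: every member of 𝓕
-- contains some x ∈ A and some y ∈ B x.  If A , B ∈ 𝓕 are disjoint, every member of 𝓕
-- has two elements in A ∪ B.  Either way the members of 𝓕 contain one of at most (2k)²
-- pairs, so ∣𝓕∣ ≤ 4k² C(n-2, k-2) ≤ C(n-1, k-1), because 4k²(k-1) ≤ n-1.
module Submission where

open import Defs using (g; d; Family; Admissible; length-mono; g-isMaximum)
open import Data.Fin using (Fin; zero; suc)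
open import Data.Fin.Properties using (any?)
open import Data.Fin.Subset using (Subset; inside; outside; _∈_; _∉_; _⊆_; _∪_; _∩_; _-_; ∁; ⁅_⁆; ∣_∣; Nonempty; Empty)
open import Data.Fin.Subset.Properties using (_∈?_; nonempty?; Empty-unique; ∣⊥∣≡0; drop-∷-⊆; in⊆in; out⊆; p⊆q⇒∣p∣≤∣q∣; x∈⁅x⁆; x∈⁅y⁆⇒x≡y; ∣⁅x⁆∣≡1; ∣∁p∣≡n∸∣p∣; x∈p∩q⁺; x∈p∩q⁻; x∈p∪q⁺; x∈p∪q⁻; p─q⊆p; ∣p─q∣≤∣p∣; x∈p∧x≢y⇒x∈p-y)
open import Data.List using (List; []; _∷_; _++_; map; length; concatMap)
open import Data.List.Properties using (length-++; length-map)
open import Data.List.Membership.Propositional using (find; lose) renaming (_∈_ to _∈ₗ_)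
open import Data.List.Membership.Propositional.Properties using (∈-map⁺; ∈-map⁻; ∈-++⁺ˡ; ∈-++⁺ʳ; ∈-++⁻; ∈-concatMap⁺)
open import Data.List.Relation.Unary.All as All using (All; []; _∷_)
open import Data.List.Relation.Unary.All.Properties using (¬All⇒Any¬)
open import Data.List.Relation.Unary.Any as Any using (Any; here; there)
open import Data.List.Relation.Unary.AllPairs using ([]; _∷_)
open import Data.List.Relation.Unary.Unique.Propositional using (Unique)
import Data.List.Relation.Unary.Unique.Propositional.Properties as Unique
open import Data.Nat using (ℕ; zero; suc; _+_; _*_; _^_; _∸_; _≤_; _≥_; z≤n; s≤s; s≤s⁻¹)
open import Data.Nat.Combinatorics using (_C_; nC1≡n; k>n⇒nCk≡0; nCk+nC[k+1]≡[n+1]C[k+1])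
open import Data.Nat.Properties
open import Data.Nat.Tactic.RingSolver using (solve-∀)
open import Data.Product using (∃; _×_; _,_; proj₁; proj₂)
open import Data.Sum using (inj₁; inj₂)
open import Data.Vec using ([]; _∷_; here; there)
open import Data.Vec.Properties using (∷-injectiveʳ)
open import Function using (_∘_)
open import Relation.Nullary using (¬_; Dec; yes; no; contradiction; ¬?)
open import Relation.Nullary.Decidable using (decidable-stable)
open import Relation.Binary.PropositionalEquality using (_≡_; _≢_; refl; sym; trans; cong; cong₂; subst; module ≡-Reasoning)

private
  variable
    n : ℕ

-- The absorption identity for binomial coefficients.

[k+1]*[n+1]C[k+1]≡[n+1]*nCk : ∀ n k → suc k * (suc n C suc k) ≡ suc n * (n C k)
[k+1]*[n+1]C[k+1]≡[n+1]*nCk zero    zero    = refl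
[k+1]*[n+1]C[k+1]≡[n+1]*nCk zero    (suc k) = begin
  suc (suc k) * (1 C suc (suc k))  ≡⟨ cong (suc (suc k) *_) (k>n⇒nCk≡0 {1} {suc (suc k)} (s≤s (s≤s z≤n))) ⟩
  suc (suc k) * 0                  ≡⟨ *-zeroʳ (suc (suc k)) ⟩
  0                                ≡⟨ cong (1 *_) (k>n⇒nCk≡0 {0} {suc k} (s≤s z≤n)) ⟨
  1 * (0 C suc k)                  ∎
  where open ≡-Reasoning
[k+1]*[n+1]C[k+1]≡[n+1]*nCk (suc n) zero    = begin
  1 * (suc (suc n) C 1)  ≡⟨ *-identityˡ _ ⟩
  suc (suc n) C 1        ≡⟨ nC1≡n (suc (suc n)) ⟩
  suc (suc n)            ≡⟨ *-identityʳ _ ⟨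
  suc (suc n) * 1        ∎
  where open ≡-Reasoning
-- For lower index 1 the identity is evaluated directly, since Pascal's rule would leave no smaller
-- index for the induction. In the next clause one copy of `X` is set aside, the induction
-- hypothesis treats `suc k * X` and `suc (suc k) * Y`, and Pascal's rule reassembles the results
-- into `suc n * X`.
[k+1]*[n+1]C[k+1]≡[n+1]*nCk (suc n) (suc k) = begin
  suc (suc k) * (suc (suc n) C suc (suc k))
    ≡⟨ cong (suc (suc k) *_) (nCk+nC[k+1]≡[n+1]C[k+1] (suc n) (suc k)) ⟨
  suc (suc k) * (X + Y)
    ≡⟨ *-distribˡ-+ (suc (suc k)) X Y ⟩
  (X + suc k * X) + suc (suc k) * Y
    ≡⟨ cong₂ (λ u v → (X + u) + v) ([k+1]*[n+1]C[k+1]≡[n+1]*nCk n k) ([k+1]*[n+1]C[k+1]≡[n+1]*nCk n (suc k)) ⟩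
  (X + suc n * (n C k)) + suc n * (n C suc k)
    ≡⟨ +-assoc X _ _ ⟩
  X + (suc n * (n C k) + suc n * (n C suc k))
    ≡⟨ cong (X +_) (*-distribˡ-+ (suc n) (n C k) (n C suc k)) ⟨
  X + suc n * (n C k + n C suc k)
    ≡⟨ cong (λ u → X + suc n * u) (nCk+nC[k+1]≡[n+1]C[k+1] n k) ⟩
  suc (suc n) * X
    ∎
  where
  open ≡-Reasoning
  X = suc n C suc k
  Y = suc n C suc (suc k)

-- Cardinalities of unions, punctured sets and pairs.

∣p∪q∣+∣p∩q∣≡∣p∣+∣q∣ : ∀ (p q : Subset n) → ∣ p ∪ q ∣ + ∣ p ∩ q ∣ ≡ ∣ p ∣ + ∣ q ∣
∣p∪q∣+∣p∩q∣≡∣p∣+∣q∣ []            []            = refl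
∣p∪q∣+∣p∩q∣≡∣p∣+∣q∣ (outside ∷ p) (outside ∷ q) = ∣p∪q∣+∣p∩q∣≡∣p∣+∣q∣ p q
∣p∪q∣+∣p∩q∣≡∣p∣+∣q∣ (inside  ∷ p) (outside ∷ q) = cong suc (∣p∪q∣+∣p∩q∣≡∣p∣+∣q∣ p q)
∣p∪q∣+∣p∩q∣≡∣p∣+∣q∣ (outside ∷ p) (inside  ∷ q) =
  trans (cong suc (∣p∪q∣+∣p∩q∣≡∣p∣+∣q∣ p q)) (sym (+-suc ∣ p ∣ ∣ q ∣))
∣p∪q∣+∣p∩q∣≡∣p∣+∣q∣ (inside  ∷ p) (inside  ∷ q) = cong suc
  (trans (+-suc ∣ p ∪ q ∣ ∣ p ∩ q ∣)
         (trans (cong suc (∣p∪q∣+∣p∩q∣≡∣p∣+∣q∣ p q)) (sym (+-suc ∣ p ∣ ∣ q ∣))))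

∣p∪q∣≤∣p∣+∣q∣ : ∀ (p q : Subset n) → ∣ p ∪ q ∣ ≤ ∣ p ∣ + ∣ q ∣
∣p∪q∣≤∣p∣+∣q∣ p q = subst (∣ p ∪ q ∣ ≤_) (∣p∪q∣+∣p∩q∣≡∣p∣+∣q∣ p q) (m≤m+n ∣ p ∪ q ∣ _)

Empty⇒∣p∣≡0 : ∀ {p : Subset n} → Empty p → ∣ p ∣ ≡ 0
Empty⇒∣p∣≡0 {n = n} e = trans (cong ∣_∣ (Empty-unique e)) (∣⊥∣≡0 n)

disjoint⇒∣p∪q∣≡∣p∣+∣q∣ : ∀ (p q : Subset n) → Empty (p ∩ q) → ∣ p ∪ q ∣ ≡ ∣ p ∣ + ∣ q ∣
disjoint⇒∣p∪q∣≡∣p∣+∣q∣ p q e = begin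
  ∣ p ∪ q ∣              ≡⟨ +-identityʳ _ ⟨
  ∣ p ∪ q ∣ + 0          ≡⟨ cong (∣ p ∪ q ∣ +_) (Empty⇒∣p∣≡0 e) ⟨
  ∣ p ∪ q ∣ + ∣ p ∩ q ∣  ≡⟨ ∣p∪q∣+∣p∩q∣≡∣p∣+∣q∣ p q ⟩
  ∣ p ∣ + ∣ q ∣          ∎
  where open ≡-Reasoning

0<∣p∣⇒Nonempty : ∀ (p : Subset n) → 1 ≤ ∣ p ∣ → Nonempty p
0<∣p∣⇒Nonempty p 1≤ = decidable-stable (nonempty? p) λ e → contradiction (Empty⇒∣p∣≡0 e) (m<n⇒n≢0 1≤)

Nonempty⇒0<∣p∣ : ∀ (p : Subset n) → Nonempty p → 1 ≤ ∣ p ∣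
Nonempty⇒0<∣p∣ p (x , x∈p) = subst (_≤ ∣ p ∣) (∣⁅x⁆∣≡1 x)
  (p⊆q⇒∣p∣≤∣q∣ λ y∈ → subst (_∈ p) (sym (x∈⁅y⁆⇒x≡y x y∈)) x∈p)

∣p∣≤1+∣p-x∣ : ∀ (p : Subset n) x → ∣ p ∣ ≤ suc ∣ p - x ∣
∣p∣≤1+∣p-x∣ p x = begin
  ∣ p ∣                  ≤⟨ p⊆q⇒∣p∣≤∣q∣ p⊆ ⟩
  ∣ ⁅ x ⁆ ∪ (p - x) ∣    ≤⟨ ∣p∪q∣≤∣p∣+∣q∣ ⁅ x ⁆ (p - x) ⟩
  ∣ ⁅ x ⁆ ∣ + ∣ p - x ∣  ≡⟨ cong (_+ ∣ p - x ∣) (∣⁅x⁆∣≡1 x) ⟩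
  suc ∣ p - x ∣          ∎
  where
  open ≤-Reasoning
  p⊆ : p ⊆ ⁅ x ⁆ ∪ (p - x)
  p⊆ {y} y∈p with y ∈? ⁅ x ⁆
  ... | yes y∈ = x∈p∪q⁺ (inj₁ y∈)
  ... | no  y∉ = x∈p∪q⁺ (inj₂ (x∈p∧x≢y⇒x∈p-y y∈p λ { refl → y∉ (x∈⁅x⁆ x) }))

x∉p-x : ∀ (p : Subset n) x → x ∉ p - x
x∉p-x (_ ∷ p) zero    ()
x∉p-x (_ ∷ p) (suc x) (there x∈) = x∉p-x p x x∈

∣⁅x⁆∪⁅y⁆∣≡2 : ∀ {x y : Fin n} → x ≢ y → ∣ ⁅ x ⁆ ∪ ⁅ y ⁆ ∣ ≡ 2
∣⁅x⁆∪⁅y⁆∣≡2 {x = x} {y} x≢y =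
  trans (disjoint⇒∣p∪q∣≡∣p∣+∣q∣ ⁅ x ⁆ ⁅ y ⁆ disj) (cong₂ _+_ (∣⁅x⁆∣≡1 x) (∣⁅x⁆∣≡1 y))
  where
  disj : Empty (⁅ x ⁆ ∩ ⁅ y ⁆)
  disj (z , z∈) with x∈p∩q⁻ ⁅ x ⁆ ⁅ y ⁆ z∈
  ... | z∈x , z∈y = x≢y (trans (sym (x∈⁅y⁆⇒x≡y x z∈x)) (x∈⁅y⁆⇒x≡y y z∈y))

⁅x⁆∪⁅y⁆⊆p : ∀ {p : Subset n} {x y} → x ∈ p → y ∈ p → ⁅ x ⁆ ∪ ⁅ y ⁆ ⊆ p
⁅x⁆∪⁅y⁆⊆p {p = p} {x} {y} x∈p y∈p z∈ with x∈p∪q⁻ ⁅ x ⁆ ⁅ y ⁆ z∈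
... | inj₁ z∈x = subst (_∈ p) (sym (x∈⁅y⁆⇒x≡y x z∈x)) x∈p
... | inj₂ z∈y = subst (_∈ p) (sym (x∈⁅y⁆⇒x≡y y z∈y)) y∈p

-- Enumeration of elements and of supersets.

elements : Subset n → List (Fin n)
elements []            = []
elements (inside  ∷ p) = zero ∷ map suc (elements p)
elements (outside ∷ p) = map suc (elements p)

length-elements : ∀ (p : Subset n) → length (elements p) ≡ ∣ p ∣
length-elements []            = refl
length-elements (inside  ∷ p) = cong suc (trans (length-map suc (elements p)) (length-elements p))
length-elements (outside ∷ p) = trans (length-map suc (elements p)) (length-elements p)

∈-elements : ∀ {p : Subset n} {x} → x ∈ p → x ∈ₗ elements p
∈-elements {p = inside  ∷ p} here       = here refl
∈-elements {p = inside  ∷ p} (there x∈) = there (∈-map⁺ suc (∈-elements x∈))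
∈-elements {p = outside ∷ p} (there x∈) = ∈-map⁺ suc (∈-elements x∈)

-- The sets A ⊇ p with ∣ A ∣ = ∣ p ∣ + j.
supersets : Subset n → ℕ → Family n
supersets []            zero    = [] ∷ []
supersets []            (suc j) = []
supersets (inside  ∷ p) j       = map (inside ∷_) (supersets p j)
supersets (outside ∷ p) zero    = map (outside ∷_) (supersets p zero)
supersets (outside ∷ p) (suc j) = map (inside ∷_) (supersets p j) ++ map (outside ∷_) (supersets p (suc j))

-- The `j` additional elements are chosen freely from the complement of `p`; at a point outside `p`,
-- taking it or leaving it is Pascal's rule.
length-supersets : ∀ (p : Subset n) j → length (supersets p j) ≡ ∣ ∁ p ∣ C j
length-supersets []            zero    = refl
length-supersets []            (suc j) = sym (k>n⇒nCk≡0 {0} {suc j} (s≤s z≤n))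
length-supersets (inside  ∷ p) j       = trans (length-map _ (supersets p j)) (length-supersets p j)
length-supersets (outside ∷ p) zero    = trans (length-map _ (supersets p zero)) (length-supersets p zero)
length-supersets (outside ∷ p) (suc j) = begin
  length (map (inside ∷_) (supersets p j) ++ map (outside ∷_) (supersets p (suc j)))
    ≡⟨ length-++ (map (inside ∷_) (supersets p j)) ⟩
  length (map (inside ∷_) (supersets p j)) + length (map (outside ∷_) (supersets p (suc j)))
    ≡⟨ cong₂ _+_ (trans (length-map _ (supersets p j)) (length-supersets p j))
                 (trans (length-map _ (supersets p (suc j))) (length-supersets p (suc j))) ⟩
  ∣ ∁ p ∣ C j + ∣ ∁ p ∣ C suc j
    ≡⟨ nCk+nC[k+1]≡[n+1]C[k+1] ∣ ∁ p ∣ j ⟩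
  suc ∣ ∁ p ∣ C suc j
    ∎
  where open ≡-Reasoning

∈-supersets⁺ : ∀ (p : Subset n) {A} j → p ⊆ A → ∣ A ∣ ≡ ∣ p ∣ + j → A ∈ₗ supersets p j
∈-supersets⁺ []            {[]}          zero    _   _  = here refl
∈-supersets⁺ (inside  ∷ p) {inside  ∷ A} j       p⊆A eq = ∈-map⁺ _ (∈-supersets⁺ p j (drop-∷-⊆ p⊆A) (suc-injective eq))
∈-supersets⁺ (inside  ∷ p) {outside ∷ A} j       p⊆A eq with () ← p⊆A here
-- An element of the larger set outside `p` would make it strictly larger than `p`, while `j = 0`
-- forces equal sizes.
∈-supersets⁺ (outside ∷ p) {inside  ∷ A} zero    p⊆A eq = contradiction (p⊆q⇒∣p∣≤∣q∣ (drop-∷-⊆ p⊆A))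
  (<⇒≱ (≤-reflexive (trans eq (+-identityʳ ∣ p ∣))))
∈-supersets⁺ (outside ∷ p) {outside ∷ A} zero    p⊆A eq = ∈-map⁺ _ (∈-supersets⁺ p zero (drop-∷-⊆ p⊆A) eq)
∈-supersets⁺ (outside ∷ p) {inside  ∷ A} (suc j) p⊆A eq = ∈-++⁺ˡ
  (∈-map⁺ _ (∈-supersets⁺ p j (drop-∷-⊆ p⊆A) (suc-injective (trans eq (+-suc ∣ p ∣ j)))))
∈-supersets⁺ (outside ∷ p) {outside ∷ A} (suc j) p⊆A eq = ∈-++⁺ʳ (map (inside ∷_) (supersets p j))
  (∈-map⁺ _ (∈-supersets⁺ p (suc j) (drop-∷-⊆ p⊆A) eq))

∈-supersets⁻ : ∀ (p : Subset n) {A} j → A ∈ₗ supersets p j → p ⊆ A × ∣ A ∣ ≡ ∣ p ∣ + j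
∈-supersets⁻ []            zero (here refl) = (λ x∈ → x∈) , refl
∈-supersets⁻ (inside  ∷ p) j    A∈ with ∈-map⁻ _ A∈
... | _ , A∈′ , refl with ∈-supersets⁻ p j A∈′
...   | p⊆A , eq = in⊆in p⊆A , cong suc eq
∈-supersets⁻ (outside ∷ p) zero A∈ with ∈-map⁻ _ A∈
... | _ , A∈′ , refl with ∈-supersets⁻ p zero A∈′
...   | p⊆A , eq = out⊆ p⊆A , eq
∈-supersets⁻ (outside ∷ p) (suc j) A∈ with ∈-++⁻ (map (inside ∷_) (supersets p j)) A∈
... | inj₁ A∈ˡ with ∈-map⁻ _ A∈ˡ
...   | _ , A∈′ , refl with ∈-supersets⁻ p j A∈′
...     | p⊆A , eq = out⊆ p⊆A , trans (cong suc eq) (sym (+-suc ∣ p ∣ j))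
∈-supersets⁻ (outside ∷ p) (suc j) A∈ | inj₂ A∈ʳ with ∈-map⁻ _ A∈ʳ
...   | _ , A∈′ , refl with ∈-supersets⁻ p (suc j) A∈′
...     | p⊆A , eq = out⊆ p⊆A , eq

supersets-unique : ∀ (p : Subset n) j → Unique (supersets p j)
supersets-unique []            zero    = [] ∷ []
supersets-unique []            (suc j) = []
supersets-unique (inside  ∷ p) j       = Unique.map⁺ ∷-injectiveʳ (supersets-unique p j)
supersets-unique (outside ∷ p) zero    = Unique.map⁺ ∷-injectiveʳ (supersets-unique p zero)
supersets-unique (outside ∷ p) (suc j) =
  Unique.++⁺ (Unique.map⁺ ∷-injectiveʳ (supersets-unique p j))
             (Unique.map⁺ ∷-injectiveʳ (supersets-unique p (suc j)))
             λ { (A∈ , A∈′) → disjoint (∈-map⁻ _ A∈) (∈-map⁻ _ A∈′) }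
  where
  disjoint : ∀ {A xs ys} → ∃ (λ B → B ∈ₗ xs × A ≡ inside ∷ B) → ¬ ∃ (λ B → B ∈ₗ ys × A ≡ outside ∷ B)
  disjoint (_ , _ , refl) (_ , _ , ())

-- Counting bounds for stars and for families covered by pairs.

length-concatMap-≤ : ∀ {A B : Set} (f : A → List B) {m} → (∀ x → length (f x) ≤ m) →
                     ∀ xs → length (concatMap f xs) ≤ length xs * m
length-concatMap-≤ f         f≤ []       = z≤n
length-concatMap-≤ f {m = m} f≤ (x ∷ xs) = begin
  length (f x ++ concatMap f xs)          ≡⟨ length-++ (f x) ⟩
  length (f x) + length (concatMap f xs)  ≤⟨ +-mono-≤ (f≤ x) (length-concatMap-≤ f f≤ xs) ⟩
  m + length xs * m                       ∎
  where open ≤-Reasoning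

-- Once `x` is fixed, the other `k` elements of a member come from the remaining `n` points. Writing
-- the parameters as successors avoids subtraction in the binomial.
star-bound : ∀ (𝓕 : Family (suc n)) {k} → Unique 𝓕 → All (λ A → ∣ A ∣ ≡ suc k) 𝓕 →
             ∀ x → All (x ∈_) 𝓕 → length 𝓕 ≤ n C k
star-bound {n = n} 𝓕 {k} unique sizes x x∈ = begin
  length 𝓕                     ≤⟨ length-mono unique ⊆star ⟩
  length (supersets ⁅ x ⁆ k)   ≡⟨ length-supersets ⁅ x ⁆ k ⟩
  ∣ ∁ ⁅ x ⁆ ∣ C k              ≡⟨ cong (_C k) (trans (∣∁p∣≡n∸∣p∣ ⁅ x ⁆) (cong (suc n ∸_) (∣⁅x⁆∣≡1 x))) ⟩
  n C k                        ∎
  where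
  open ≤-Reasoning
  ⊆star : ∀ {A} → A ∈ₗ 𝓕 → A ∈ₗ supersets ⁅ x ⁆ k
  ⊆star {A} A∈ = ∈-supersets⁺ ⁅ x ⁆ k
    (λ y∈ → subst (_∈ A) (sym (x∈⁅y⁆⇒x≡y x y∈)) (All.lookup x∈ A∈))
    (trans (All.lookup sizes A∈) (cong (_+ k) (sym (∣⁅x⁆∣≡1 x))))

-- Q x lists the candidates for a second element once x has been chosen in P.
cover-bound : ∀ (𝓕 : Family (suc n)) {k m} → Unique 𝓕 → All (λ A → ∣ A ∣ ≡ suc k) 𝓕 →
              (P : Subset (suc n)) (Q : Fin (suc n) → Subset (suc n)) →
              ∣ P ∣ ≤ m → (∀ x → ∣ Q x ∣ ≤ m) → (∀ x → x ∉ Q x) →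
              (∀ {A} → A ∈ₗ 𝓕 → ∃ λ x → ∃ λ y → x ∈ P × y ∈ Q x × x ∈ A × y ∈ A) →
              length 𝓕 * n ≤ m * m * k * (n C k)
cover-bound []          _      _           _ _ _  _  _   _     = z≤n
-- A one-element member cannot contain both `x` and `y`, which differ because `x ∉ Q x`.
cover-bound (A ∷ 𝓕) {zero} _ (∣A∣≡1 ∷ _) P Q P≤ Q≤ x∉Q meets with meets (here refl)
... | x , y , _ , y∈Q , x∈A , y∈A =
  contradiction (subst (_≤ 1) (∣⁅x⁆∪⁅y⁆∣≡2 {x = x} {y} λ { refl → x∉Q x y∈Q })
                  (subst (∣ ⁅ x ⁆ ∪ ⁅ y ⁆ ∣ ≤_) ∣A∣≡1 (p⊆q⇒∣p∣≤∣q∣ (⁅x⁆∪⁅y⁆⊆p x∈A y∈A))))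
                λ { (s≤s ()) }
cover-bound {n = zero}  𝓕@(_ ∷ _) {suc k} _ _ _ _ _ _ _ _ = ≤-trans (≤-reflexive (*-zeroʳ (length 𝓕))) z≤n
cover-bound {n = suc n} 𝓕@(_ ∷ _) {suc k} {m} unique sizes P Q P≤ Q≤ x∉Q meets = begin
  -- In this clause the ground set has `n + 2` points and members have `k + 2` elements, so at most
  -- `n C k` of them contain a given pair. The factor `suc n` stands on the left in place of a
  -- division.
  length 𝓕 * suc n                           ≤⟨ *-monoˡ-≤ (suc n) ∣𝓕∣≤ ⟩
  m * (m * (n C k)) * suc n                  ≡⟨ rearrange m (n C k) (suc n) ⟩
  -- Absorption trades the number of sets through a pair for the size of a star.
  m * m * (suc n * (n C k))                  ≡⟨ cong (m * m *_) ([k+1]*[n+1]C[k+1]≡[n+1]*nCk n k) ⟨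
  m * m * (suc k * (suc n C suc k))          ≡⟨ *-assoc (m * m) (suc k) _ ⟨
  m * m * suc k * (suc n C suc k)            ∎
  where
  open ≤-Reasoning

  rearrange : ∀ a b c → a * (a * b) * c ≡ a * a * (c * b)
  rearrange = solve-∀

  -- The diagonal is made empty so that the bound `n C k` holds for all `x` and `y`, as
  -- `length-concatMap-≤` demands. Nothing is lost, since only pairs with `y ∈ Q x`, hence `x ≢ y`,
  -- have to be covered.
  through : Fin (suc (suc n)) → Fin (suc (suc n)) → Family (suc (suc n))
  through x y with x ∈? ⁅ y ⁆
  ... | yes _ = []
  ... | no  _ = supersets (⁅ x ⁆ ∪ ⁅ y ⁆) k

  length-through : ∀ x y → length (through x y) ≤ n C k
  length-through x y with x ∈? ⁅ y ⁆
  ... | yes _  = z≤n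
  ... | no  x∉ = ≤-reflexive (trans (length-supersets (⁅ x ⁆ ∪ ⁅ y ⁆) k)
    (cong (_C k) (trans (∣∁p∣≡n∸∣p∣ (⁅ x ⁆ ∪ ⁅ y ⁆))
      (cong (suc (suc n) ∸_) (∣⁅x⁆∪⁅y⁆∣≡2 {x = x} {y} λ { refl → x∉ (x∈⁅x⁆ x) })))))

  ∈-through : ∀ {A x y} → A ∈ₗ 𝓕 → x ≢ y → x ∈ A → y ∈ A → A ∈ₗ through x y
  ∈-through {A} {x} {y} A∈ x≢y x∈A y∈A with x ∈? ⁅ y ⁆
  ... | yes x∈ = contradiction (x∈⁅y⁆⇒x≡y y x∈) x≢y
  ... | no  _  = ∈-supersets⁺ (⁅ x ⁆ ∪ ⁅ y ⁆) k (⁅x⁆∪⁅y⁆⊆p x∈A y∈A)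
    (trans (All.lookup sizes A∈) (cong (_+ k) (sym (∣⁅x⁆∪⁅y⁆∣≡2 x≢y))))

  throughQ : Fin (suc (suc n)) → Family (suc (suc n))
  throughQ x = concatMap (through x) (elements (Q x))

  length-throughQ : ∀ x → length (throughQ x) ≤ m * (n C k)
  length-throughQ x = ≤-trans (length-concatMap-≤ (through x) (length-through x) (elements (Q x)))
    (*-monoˡ-≤ (n C k) (subst (_≤ m) (sym (length-elements (Q x))) (Q≤ x)))

  ⊆cover : ∀ {A} → A ∈ₗ 𝓕 → A ∈ₗ concatMap throughQ (elements P)
  ⊆cover A∈ with meets A∈
  ... | x , y , x∈P , y∈Q , x∈A , y∈A =
    ∈-concatMap⁺ throughQ (lose (∈-elements x∈P)
      (∈-concatMap⁺ (through x) (lose (∈-elements y∈Q)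
        (∈-through A∈ (λ { refl → x∉Q x y∈Q }) x∈A y∈A))))

  ∣𝓕∣≤ : length 𝓕 ≤ m * (m * (n C k))
  ∣𝓕∣≤ = ≤-trans (length-mono unique ⊆cover)
    (≤-trans (length-concatMap-≤ throughQ length-throughQ (elements P))
      (*-monoˡ-≤ (m * (n C k)) (subst (_≤ m) (sym (length-elements P)) P≤)))

-- The upper bound.

two-elements : ∀ (p : Subset n) → 2 ≤ ∣ p ∣ → ∃ λ x → ∃ λ y → x ∈ p × y ∈ p × y ≢ x
two-elements p 2≤ with 0<∣p∣⇒Nonempty p (≤-trans (s≤s z≤n) 2≤)
... | x , x∈p with 0<∣p∣⇒Nonempty (p - x) (s≤s⁻¹ (≤-trans 2≤ (∣p∣≤1+∣p-x∣ p x)))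
...   | y , y∈ = x , y , x∈p , p─q⊆p p ⁅ x ⁆ y∈ , λ { refl → x∉p-x p x y∈ }

-- Since `A ∩ B` is empty, `d A B E` reduces to `∣ B ∩ E ∣ + ∣ E ∩ A ∣`. These two intersections are
-- disjoint, so the sum is the size of their union, which lies in both `A ∪ B` and `E`.
disjoint⇒two-elements : ∀ {A B : Subset n} → Empty (A ∩ B) → ∀ E → 2 ≤ d A B E →
                        ∃ λ x → ∃ λ y → x ∈ A ∪ B × y ∈ (A ∪ B) - x × x ∈ E × y ∈ E
disjoint⇒two-elements {A = A} {B} disj E 2≤d =
  let x , y , x∈ , y∈ , y≢x = two-elements ((B ∩ E) ∪ (E ∩ A)) 2≤
  in  x , y , proj₁ (split x∈) , x∈p∧x≢y⇒x∈p-y (proj₁ (split y∈)) y≢x , proj₂ (split x∈) , proj₂ (split y∈)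
  where
  disj′ : Empty ((B ∩ E) ∩ (E ∩ A))
  disj′ (z , z∈) with x∈p∩q⁻ (B ∩ E) (E ∩ A) z∈
  ... | z∈BE , z∈EA = disj (z , x∈p∩q⁺ (proj₂ (x∈p∩q⁻ E A z∈EA) , proj₁ (x∈p∩q⁻ B E z∈BE)))

  2≤ : 2 ≤ ∣ (B ∩ E) ∪ (E ∩ A) ∣
  2≤ = subst (2 ≤_)
    (trans (cong (λ i → i + ∣ B ∩ E ∣ + ∣ E ∩ A ∣) (Empty⇒∣p∣≡0 disj))
           (sym (disjoint⇒∣p∪q∣≡∣p∣+∣q∣ (B ∩ E) (E ∩ A) disj′))) 2≤d

  split : ∀ {z} → z ∈ (B ∩ E) ∪ (E ∩ A) → z ∈ A ∪ B × z ∈ E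
  split z∈ with x∈p∪q⁻ (B ∩ E) (E ∩ A) z∈
  ... | inj₁ z∈BE = x∈p∪q⁺ (inj₂ (proj₁ (x∈p∩q⁻ B E z∈BE))) , proj₂ (x∈p∩q⁻ B E z∈BE)
  ... | inj₂ z∈EA = x∈p∪q⁺ (inj₁ (proj₂ (x∈p∩q⁻ E A z∈EA))) , proj₁ (x∈p∩q⁻ E A z∈EA)

-- With `K = k + 1` the cubes differ by 4K², which is at least 2. The extra 2 excludes a one-point
-- ground set and absorbs the `suc` in `suc n`.
4k²[k-1]+2≤4k³ : ∀ k → suc (suc ((2 * suc k) * (2 * suc k) * k)) ≤ 4 * suc k ^ 3
4k²[k-1]+2≤4k³ k = subst (suc (suc ((2 * suc k) * (2 * suc k) * k)) ≤_) (sym (expand k)) (m≤m+n _ _)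
  where
  expand : ∀ k → 4 * ((1 + k) * ((1 + k) * ((1 + k) * 1))) ≡ (2 + (2 * (1 + k)) * (2 * (1 + k)) * k) + (2 + 8 * k + 4 * (k * k))
  expand = solve-∀

upper-bound : ∀ n k → 4 * suc k ^ 3 ≤ suc n → (𝓕 : Family (suc n)) →
              Admissible (suc n) (suc k) 2 𝓕 → length 𝓕 ≤ n C k
-- Excluding `n = 0` makes the final cancellation of the factor `n` legitimate.
upper-bound zero      k 4k³≤n _ _ = contradiction (≤-trans (4k²[k-1]+2≤4k³ k) 4k³≤n) λ { (s≤s ()) }
upper-bound (suc _)   k 4k³≤n []        _ = z≤n
upper-bound n@(suc _) k 4k³≤n 𝓕@(A ∷ _) (unique , sizes , h)
  with any? (λ x → All.all? (x ∈?_) 𝓕)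
     | Any.any? (λ B → Any.any? (λ E → ¬? (nonempty? (B ∩ E))) 𝓕) 𝓕
... | yes (x , x∈) | _ = star-bound 𝓕 unique sizes x x∈
... | no  ¬star    | disjoint-pair? = *-cancelʳ-≤ (length 𝓕) (n C k) n (begin
  length 𝓕 * n           ≤⟨ covered disjoint-pair? ⟩
  m * m * k * (n C k)    ≤⟨ *-monoˡ-≤ (n C k) m²k≤n ⟩
  n * (n C k)            ≡⟨ *-comm n (n C k) ⟩
  (n C k) * n            ∎)
  where
  open ≤-Reasoning

  -- This bounds the union of two members and therefore also a single member, so both cases share
  -- one constant.
  m = 2 * suc k

  m²k≤n : m * m * k ≤ n
  m²k≤n = <⇒≤ (s≤s⁻¹ (≤-trans (4k²[k-1]+2≤4k³ k) 4k³≤n))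

  avoiding : ∀ x → ∃ λ B → B ∈ₗ 𝓕 × x ∉ B
  avoiding x = find (¬All⇒Any¬ (x ∈?_) 𝓕 λ x∈ → ¬star (x , x∈))

  ∣B∣≤m : ∀ {B} → B ∈ₗ 𝓕 → ∣ B ∣ ≤ m
  ∣B∣≤m B∈ = subst (_≤ m) (sym (All.lookup sizes B∈)) (m≤m+n (suc k) _)

  covered : Dec (Any (λ B → Any (λ E → ¬ Nonempty (B ∩ E)) 𝓕) 𝓕) → length 𝓕 * n ≤ m * m * k * (n C k)
  covered (yes disjoint-pair) with find disjoint-pair
  ... | B , B∈ , disjoint-from-B with find disjoint-from-B
  ...   | E , E∈ , disj = cover-bound 𝓕 unique sizes (B ∪ E) (λ x → (B ∪ E) - x) ∣B∪E∣≤m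
    (λ x → ≤-trans (∣p─q∣≤∣p∣ (B ∪ E) ⁅ x ⁆) ∣B∪E∣≤m) (x∉p-x (B ∪ E))
    (λ {D} D∈ → disjoint⇒two-elements disj D (h B∈ E∈ D∈))
    where
    ∣B∪E∣≤m : ∣ B ∪ E ∣ ≤ m
    ∣B∪E∣≤m = begin
      ∣ B ∪ E ∣              ≤⟨ ∣p∪q∣≤∣p∣+∣q∣ B E ⟩
      ∣ B ∣ + ∣ E ∣          ≡⟨ cong₂ _+_ (All.lookup sizes B∈) (All.lookup sizes E∈) ⟩
      suc k + suc k          ≡⟨ cong (suc k +_) (+-identityʳ (suc k)) ⟨
      2 * suc k              ∎
  -- The second set depends on the first chosen point: it is a member avoiding `x`, so the element
  -- of it found in `E` differs from `x`.
  covered (no ¬disjoint-pair) = cover-bound 𝓕 unique sizes A (proj₁ ∘ avoiding) (∣B∣≤m (here refl))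
    (λ x → ∣B∣≤m (proj₁ (proj₂ (avoiding x)))) (λ x → proj₂ (proj₂ (avoiding x))) meets
    where
    intersecting : ∀ {B E} → B ∈ₗ 𝓕 → E ∈ₗ 𝓕 → Nonempty (B ∩ E)
    intersecting {B} {E} B∈ E∈ = decidable-stable (nonempty? (B ∩ E)) λ e → ¬disjoint-pair (lose B∈ (lose E∈ e))

    meets : ∀ {E} → E ∈ₗ 𝓕 → ∃ λ x → ∃ λ y → x ∈ A × y ∈ proj₁ (avoiding x) × x ∈ E × y ∈ E
    meets {E} E∈ with intersecting (here refl) E∈
    ... | x , x∈ with intersecting (proj₁ (proj₂ (avoiding x))) E∈
    ...   | y , y∈ with x∈p∩q⁻ A E x∈ | x∈p∩q⁻ (proj₁ (avoiding x)) E y∈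
    ...     | x∈A , x∈E | y∈B , y∈E = x , y , x∈A , y∈B , x∈E , y∈E

-- The lower bound and the conclusion.

star-admissible : ∀ (x : Fin n) k → Admissible n (suc k) 3 (supersets ⁅ x ⁆ k)
star-admissible x k =
    supersets-unique ⁅ x ⁆ k
  , All.tabulate (λ A∈ → trans (proj₂ (∈-supersets⁻ ⁅ x ⁆ k A∈)) (cong (_+ k) (∣⁅x⁆∣≡1 x)))
  -- Each of the three intersections contains `x`, also when members coincide, and contributes at
  -- least 1.
  , λ A∈ B∈ E∈ → +-mono-≤ (+-mono-≤ (meet A∈ B∈) (meet B∈ E∈)) (meet E∈ A∈)
  where
  x∈ : ∀ {A} → A ∈ₗ supersets ⁅ x ⁆ k → x ∈ A
  x∈ A∈ = proj₁ (∈-supersets⁻ ⁅ x ⁆ k A∈) (x∈⁅x⁆ x)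

  meet : ∀ {A B} → A ∈ₗ supersets ⁅ x ⁆ k → B ∈ₗ supersets ⁅ x ⁆ k → 1 ≤ ∣ A ∩ B ∣
  meet {A} {B} A∈ B∈ = Nonempty⇒0<∣p∣ (A ∩ B) (x , x∈p∩q⁺ (x∈ A∈ , x∈ B∈))

-- A family attaining the maximum for `ℓ′` also satisfies the weaker condition for `ℓ`.
g-antitone : ∀ n k {ℓ ℓ′} → ℓ ≤ ℓ′ → g n k ℓ′ ≤ g n k ℓ
g-antitone n k {ℓ} {ℓ′} ℓ≤ℓ′ with proj₁ (g-isMaximum n k ℓ′)
... | 𝓕 , (unique , sizes , h) , ∣𝓕∣≡g = subst (_≤ g n k ℓ) ∣𝓕∣≡g
  (proj₂ (g-isMaximum n k ℓ) 𝓕 (unique , sizes , λ A∈ B∈ E∈ → ≤-trans ℓ≤ℓ′ (h A∈ B∈ E∈)))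

theorem2p5 : ∀ (n k : ℕ) → 1 ≤ n → 1 ≤ k → n ≥ 4 * k ^ 3 →
    g n k 2 ≡ g n k 3 × g n k 3 ≡ (n ∸ 1) C (k ∸ 1)
theorem2p5 (suc n) (suc k) _ _ n≥4k³ =
  -- The cycle from `n C k` up to the maximum for 3, on to that for 2 and back to `n C k` forces
  -- equality throughout.
  ≤-antisym (≤-trans g₂≤ ≤g₃) g₃≤g₂ , ≤-antisym (≤-trans g₃≤g₂ g₂≤) ≤g₃
  where
  g₃≤g₂ : g (suc n) (suc k) 3 ≤ g (suc n) (suc k) 2
  g₃≤g₂ = g-antitone (suc n) (suc k) (s≤s (s≤s z≤n))

  g₂≤ : g (suc n) (suc k) 2 ≤ n C k
  g₂≤ with proj₁ (g-isMaximum (suc n) (suc k) 2)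
  ... | 𝓕 , adm , ∣𝓕∣≡g = subst (_≤ n C k) ∣𝓕∣≡g (upper-bound n k n≥4k³ 𝓕 adm)

  ≤g₃ : n C k ≤ g (suc n) (suc k) 3
  ≤g₃ = subst (_≤ g (suc n) (suc k) 3)
    (trans (length-supersets {n = suc n} ⁅ zero ⁆ k)
           (cong (_C k) (trans (∣∁p∣≡n∸∣p∣ {n = suc n} ⁅ zero ⁆) (cong (suc n ∸_) (∣⁅x⁆∣≡1 {n = suc n} zero)))))
    (proj₂ (g-isMaximum (suc n) (suc k) 3) (supersets ⁅ zero ⁆ k) (star-admissible zero k))
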